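{- Let $\alpha=\alpha_1\alpha_2\ldots$ be an infinite word over the alphabet $\{0,1,2\}$ containing the letter $2$ infinitely many times. Then the class $\mathcal{G}_\alpha$ has unbounded clique-width, i.e. there is no constant $c$ such that every graph in $\mathcal{G}_\alpha$ has clique-width at most $c$.
   Context: Graphs are undirected, without loops or multiple edges. The clique-width of a finite graph $G$ is the minimum number of labels needed to construct $G$ by an expression using the following operations: creation of a new vertex with label $i$; disjoint union of two labelled graphs; $\eta_{i,j}$ ($i\neq j$), adding all edges between vertices labelled $i$ and vertices labelled $j$; $\rho_{i\to j}$, renaming label $i$ to label $j$. Let $\mathbb{N}=\{1,2,\ldots\}$. For an infinite word $\alpha=\alpha_1\alpha_2\ldots$ over $\{0,1,2\}$, the graph $\mathcal{P}^\alpha$ has vertex set $\{v_{i,j}: i,j\in\mathbb{N}\}$ (with $V_j=\{v_{i,j}: i\in\mathbb{N}\}$ the $j$th column); its only edges are between consecutive columns, and $v_{i,j}\in V_j$ is adjacent to $v_{k,j+1}\in V_{j+1}$ iff: $i=k$, when $\alpha_j=0$; $i\neq k$, when $\alpha_j=1$; $i\leq k$, when $\alpha_j=2$. The class $\mathcal{G}_\alpha$ consists of all finite induced subgraphs of $\mathcal{P}^\alpha$ (up to isomorphism). -}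

module Defs where

open import Data.Bool.Base using (if_then_else_)
open import Data.Empty using (⊥)
open import Data.Fin.Base using (Fin)
open import Data.Fin.Patterns using (0F; 1F; 2F)
open import Data.Fin.Properties using (_≟_)
open import Data.Nat.Base using (ℕ; suc; _≤_)
open import Data.Nat.Properties using (1+n≢n)
open import Data.Product.Base using (_×_; _,_; ∃-syntax; Σ-syntax)
open import Data.Sum.Base using (_⊎_; inj₁; inj₂; swap; [_,_]′)
open import Data.Sum.Relation.Binary.Pointwise using (Pointwise; inj₁; inj₂; ⊎-symmetric)
open import Data.Unit.Base using (⊤)
open import Function.Bundles using (_↔_; _↣_; _⇔_; Inverse; Injection)
open import Relation.Binary.Core using (Rel)
open import Relation.Binary.Definitions using (Symmetric; Irreflexive)
open import Relation.Binary.PropositionalEquality using (_≡_; _≢_; refl; sym; trans; cong)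
open import Relation.Nullary.Decidable.Core using (does)
open import Level using (0ℓ)

record Graph : Set₁ where
  field
    Vertex   : Set
    Adj      : Rel Vertex 0ℓ
    adj-sym  : Symmetric Adj
    loopless : Irreflexive _≡_ Adj

open Graph public

infix 4 _≅_

_≅_ : Graph → Graph → Set
G ≅ H = Σ[ f ∈ Vertex G ↔ Vertex H ]
        (∀ x y → Adj G x y ⇔ Adj H (Inverse.to f x) (Inverse.to f y))

-- A finite set of vertices is given by an injective enumeration.
induced : (H : Graph) {n : ℕ} → Fin n ↣ Vertex H → Graph
induced H {n} f = record
  { Vertex   = Fin n
  ; Adj      = λ x y → Adj H (to x) (to y)
  ; adj-sym  = adj-sym H
  ; loopless = λ x≡y → loopless H (cong to x≡y)
  }
  where open Injection f using (to)

IsFiniteInducedSubgraphOf : Graph → Graph → Set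
IsFiniteInducedSubgraphOf G H =
  ∃[ n ] Σ[ f ∈ Fin n ↣ Vertex H ] (G ≅ induced H f)

record LabelledGraph (k : ℕ) : Set₁ where
  field
    graph : Graph
    label : Vertex graph → Fin k

open LabelledGraph public

module _ {k : ℕ} where

  singleᴸ : Fin k → LabelledGraph k
  singleᴸ i = record
    { graph = record
      { Vertex   = ⊤
      ; Adj      = λ _ _ → ⊥
      ; adj-sym  = λ ()
      ; loopless = λ _ ()
      }
    ; label = λ _ → i
    }

  unionᴸ : LabelledGraph k → LabelledGraph k → LabelledGraph k
  unionᴸ A B = record
    { graph = record
      { Vertex   = Vertex G ⊎ Vertex H
      ; Adj      = Pointwise (Adj G) (Adj H)
      ; adj-sym  = ⊎-symmetric (adj-sym G) (adj-sym H)
      ; loopless = λ { refl (inj₁ e) → loopless G refl e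
                     ; refl (inj₂ e) → loopless H refl e }
      }
    ; label = [ label A , label B ]′
    }
    where
    G = graph A
    H = graph B

  joinᴸ : (i j : Fin k) → i ≢ j → LabelledGraph k → LabelledGraph k
  joinᴸ i j i≢j A = record
    { graph = record
      { Vertex   = Vertex G
      ; Adj      = λ x y → Adj G x y ⊎ (Joined x y ⊎ Joined y x)
      ; adj-sym  = λ { (inj₁ e) → inj₁ (adj-sym G e)
                     ; (inj₂ e) → inj₂ (swap e) }
      ; loopless = λ { refl (inj₁ e) → loopless G refl e
                     ; refl (inj₂ (inj₁ (p , q))) → i≢j (trans (sym p) q)
                     ; refl (inj₂ (inj₂ (p , q))) → i≢j (trans (sym p) q) }
      }
    ; label = label A
    }
    where
    G = graph A
    Joined : Rel (Vertex G) 0ℓ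
    Joined x y = label A x ≡ i × label A y ≡ j

  relabelᴸ : (i j : Fin k) → LabelledGraph k → LabelledGraph k
  relabelᴸ i j A = record
    { graph = graph A
    ; label = λ x → if does (label A x ≟ i) then j else label A x
    }

data Expr (k : ℕ) : Set where
  single : (i : Fin k) → Expr k
  _⊕_    : (s t : Expr k) → Expr k
  η      : (i j : Fin k) → i ≢ j → Expr k → Expr k
  ρ      : (i j : Fin k) → Expr k → Expr k

⟦_⟧ : ∀ {k} → Expr k → LabelledGraph k
⟦ single i ⟧    = singleᴸ i
⟦ s ⊕ t ⟧       = unionᴸ ⟦ s ⟧ ⟦ t ⟧
⟦ η i j i≢j t ⟧ = joinᴸ i j i≢j ⟦ t ⟧
⟦ ρ i j t ⟧     = relabelᴸ i j ⟦ t ⟧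

ConstructibleWith : ℕ → Graph → Set
ConstructibleWith k G = ∃[ t ] (graph (⟦_⟧ {k} t) ≅ G)

-- The minimum is expressed as a relation, since a function would require
-- deciding the existence of expressions. The graph with no vertices has no
-- expression, hence no clique-width.
IsCliqueWidth : Graph → ℕ → Set
IsCliqueWidth G k =
  ConstructibleWith k G × (∀ j → ConstructibleWith j G → k ≤ j)

-- Rows, columns and letters are all indexed from 0 instead of 1.
Word : Set
Word = ℕ → Fin 3

InfinitelyOften : Fin 3 → Word → Set
InfinitelyOften a α = ∀ n → ∃[ m ] (n ≤ m × α m ≡ a)

RowRel : Fin 3 → Rel ℕ 0ℓ
RowRel 0F i k = i ≡ k
RowRel 1F i k = i ≢ k
RowRel 2F i k = i ≤ k

-- The pair (i , j) is the vertex in row i of column j.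
Link : Word → Rel (ℕ × ℕ) 0ℓ
Link α (i , j) (k , l) = l ≡ suc j × RowRel (α j) i k

𝒫 : Word → Graph
𝒫 α = record
  { Vertex   = ℕ × ℕ
  ; Adj      = λ u v → Link α u v ⊎ Link α v u
  ; adj-sym  = swap
  ; loopless = λ { refl (inj₁ (e , _)) → 1+n≢n (sym e)
                 ; refl (inj₂ (e , _)) → 1+n≢n (sym e) }
  }

𝒢 : Word → Graph → Set
𝒢 α G = IsFiniteInducedSubgraphOf G (𝒫 α)

-- Constructively this is the weakest form of the bound (it follows from "some
-- expression with at most c labels exists"), so its negation is the strongest
-- form of unboundedness as a negative statement.
BoundedCliqueWidth : (Graph → Set) → Set₁
BoundedCliqueWidth 𝒞 =
  ∃[ c ] (∀ G → 𝒞 G → ∀ k → IsCliqueWidth G k → k ≤ c)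

{-# OPTIONS --safe #-}
module Submission where

-- Let X be the vertex set of a subexpression with k labels inside a large grid
-- of 𝒫 α. Two vertices of X with the same label have the same neighbours
-- outside X. So if edges between X and its complement occur between the
-- columns j and j + 1, the pair (j mod 3, label of the end in X) determines j,
-- and such edges occur for at most 3k values of j. A column with letter 2 that
-- meets both X and its complement gives such an edge, and so does every change
-- of side along a row. If X contained one column and missed another, every row
-- would change side, and (code of j, direction, label) would determine the row,
-- which is impossible for many rows. It follows by induction on expressions that
-- X contains no column with letter 2: otherwise X = Y ∪ Z meets every such
-- column, so each of them is cut properly by Y or by Z, which happens for at
-- most 6k columns. The whole grid contradicts this.

open import Data.Bool.Base using (Bool; true; false)
open import Data.Bool.Properties using () renaming (_≟_ to _≟ᵇ_)
open import Data.Empty using (⊥-elim)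
open import Data.Fin.Base
  using (Fin; zero; suc; toℕ; fromℕ; fromℕ<; combine; remQuot; join; splitAt)
open import Data.Fin.Patterns using (0F; 1F; 2F)
open import Data.Fin.Properties
  using (any?; ¬∀⟶∃¬; toℕ-injective; toℕ<n; toℕ-fromℕ; toℕ-fromℕ<; toℕ≤pred[n];
         combine-injective; combine-remQuot; remQuot-combine; injective⇒≤;
         splitAt-join)
open import Data.List.Base using (List; []; _∷_; allFin; cartesianProduct)
open import Data.List.Membership.Propositional using (_∈_)
open import Data.List.Membership.Propositional.Properties
  using (∈-allFin; ∈-cartesianProduct⁺)
open import Data.List.Relation.Unary.Any using (here; there)
open import Data.Maybe.Base using (Maybe; just; nothing; is-just)
open import Data.Maybe.Properties using (just-injective)
open import Data.Nat.Base using (ℕ; zero; suc; _+_; _*_; _≤_; _<_; s≤s)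
open import Data.Nat.Induction using (<-rec)
open import Data.Nat.Properties as ℕ
  using (_<?_; _≤?_; ≤-refl; ≤-reflexive; ≤-trans; ≤-antisym; <-trans; <⇒≱;
         <-irrefl; <-cmp; ≮⇒≥; *-mono-≤; *-monoʳ-≤; +-mono-≤)
open import Data.Product.Base using (_×_; _,_; ∃; ∃₂; proj₁; proj₂)
open import Data.Product.Properties using (,-injectiveˡ)
open import Data.Sum.Base as Sum using (_⊎_; inj₁; inj₂)
open import Data.Sum.Properties using (inj₁-injective; inj₂-injective)
open import Data.Sum.Relation.Binary.Pointwise using (inj₁; inj₂)
open import Data.Unit.Base using (tt)
open import Function.Base using (_∘_)
open import Function.Bundles
  using (_↔_; _↣_; Equivalence; Injection; Inverse; mk↔ₛ′; mk↣; mk⇔)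
open import Relation.Binary.Definitions
  using (Decidable; tri<; tri≈; tri>)
open import Relation.Binary.PropositionalEquality
  using (_≡_; _≢_; refl; sym; trans; cong; cong₂)
open import Relation.Nullary
  using (¬_; Dec; yes; no; ¬?; _×-dec_; _⊎-dec_; contradiction; decidable-stable)

open import Defs

-- Gaps between consecutive columns, and the row relations across them.

residue : ℕ → Fin 3
residue 0                   = 0F
residue 1                   = 1F
residue 2                   = 2F
residue (suc (suc (suc j))) = residue j

residue-suc : ∀ j → residue j ≢ residue (suc j)
residue-suc 0                   ()
residue-suc 1                   ()
residue-suc 2                   ()
residue-suc (suc (suc (suc j))) = residue-suc j

residue-2+ : ∀ j → residue j ≢ residue (suc (suc j))
residue-2+ 0                   ()
residue-2+ 1                   ()
residue-2+ 2                   ()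
residue-2+ (suc (suc (suc j))) = residue-2+ j

-- Gap `j` separates columns `j` and `suc j`. In use, `c` is the column of the end inside the set
-- and `d` that of the end outside.
Straddles : ℕ → ℕ → ℕ → Set
Straddles j c d = (c ≡ j × d ≡ suc j) ⊎ (c ≡ suc j × d ≡ j)

-- Since `d` and `c′` are consecutive columns, `i` and `j` differ by at most two, and residues
-- modulo 3 tell such gaps apart.
straddles-unique : ∀ {i j c c′ d d′} → residue i ≡ residue j →
  Straddles i c d → Straddles j c′ d′ → (d ≡ suc c′ ⊎ c′ ≡ suc d) → i ≡ j
straddles-unique {i} {j} r (inj₁ (_ , refl)) (inj₁ (refl , _)) (inj₁ refl) = refl
straddles-unique {i} {j} r (inj₁ (_ , refl)) (inj₁ (refl , _)) (inj₂ refl) =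
  ⊥-elim (residue-2+ i r)
straddles-unique {i} {j} r (inj₁ (_ , refl)) (inj₂ (refl , _)) (inj₁ refl) =
  ⊥-elim (residue-suc j (sym r))
straddles-unique {i} {j} r (inj₁ (_ , refl)) (inj₂ (refl , _)) (inj₂ refl) =
  ⊥-elim (residue-suc i r)
straddles-unique {i} {j} r (inj₂ (_ , refl)) (inj₁ (refl , _)) (inj₁ refl) =
  ⊥-elim (residue-suc j (sym r))
straddles-unique {i} {j} r (inj₂ (_ , refl)) (inj₁ (refl , _)) (inj₂ refl) =
  ⊥-elim (residue-suc i r)
straddles-unique {i} {j} r (inj₂ (_ , refl)) (inj₂ (refl , _)) (inj₁ refl) =
  ⊥-elim (residue-2+ j (sym r))
straddles-unique {i} {j} r (inj₂ (_ , refl)) (inj₂ (refl , _)) (inj₂ refl) = refl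

-- The hypotheses are what twins in rows `i` and `i′` satisfy against the next column. Letter 0 is
-- settled by the first, letter 1 by the third, and letter 2 by the first two through antisymmetry.
rowRel-separatesˡ : ∀ a {i i′} →
  (RowRel a i i → RowRel a i′ i) → (RowRel a i′ i′ → RowRel a i i′) →
  (RowRel a i′ i → RowRel a i i) → i ≡ i′
rowRel-separatesˡ 0F f g h = sym (f refl)
rowRel-separatesˡ 1F f g h =
  sym (decidable-stable (_ ℕ.≟ _) λ i′≢i → h i′≢i refl)
rowRel-separatesˡ 2F f g h = ≤-antisym (g ≤-refl) (f ≤-refl)

rowRel-separatesʳ : ∀ a {i i′} →
  (RowRel a i i → RowRel a i i′) → (RowRel a i′ i′ → RowRel a i′ i) →
  (RowRel a i i′ → RowRel a i i) → i ≡ i′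
rowRel-separatesʳ 0F f g h = f refl
rowRel-separatesʳ 1F f g h = decidable-stable (_ ℕ.≟ _) λ i≢i′ → h i≢i′ refl
rowRel-separatesʳ 2F f g h = ≤-antisym (f ≤-refl) (g ≤-refl)

rowRel? : ∀ a → Decidable (RowRel a)
rowRel? 0F i k = i ℕ.≟ k
rowRel? 1F i k = ¬? (i ℕ.≟ k)
rowRel? 2F i k = i ≤? k

link? : ∀ α → Decidable (Link α)
link? α (i , j) (k , l) = (l ℕ.≟ suc j) ×-dec rowRel? (α j) i k

𝒫-adj? : ∀ α → Decidable (Adj (𝒫 α))
𝒫-adj? α u v = link? α u v ⊎-dec link? α v u

-- Colour changes along a row.

change-up-to : (c : ℕ → Bool) → ∀ j →
  c j ≡ c 0 ⊎ ∃ λ i → suc i ≤ j × c i ≢ c (suc i)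
change-up-to c zero = inj₁ refl
change-up-to c (suc j) with change-up-to c j
... | inj₂ (i , i<j , i≢) = inj₂ (i , ℕ.m≤n⇒m≤1+n i<j , i≢)
... | inj₁ cj≡c0 with c j ≟ᵇ c (suc j)
...   | yes eq = inj₁ (trans (sym eq) cj≡c0)
...   | no  j≢ = inj₂ (j , ≤-refl , j≢)

-- Comparing both positions with position 0 makes the order of `a` and `b` irrelevant.
change : (c : ℕ → Bool) → ∀ {a b L} → a < L → b < L → c a ≢ c b →
  ∃ λ i → suc i < L × c i ≢ c (suc i)
change c {a} {b} a<L b<L ca≢cb with change-up-to c a | change-up-to c b
... | inj₂ (i , i<a , i≢) | _ = i , ℕ.≤-<-trans i<a a<L , i≢
... | inj₁ _ | inj₂ (i , i<b , i≢) = i , ℕ.≤-<-trans i<b b<L , i≢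
... | inj₁ p | inj₁ q = contradiction (trans p (sym q)) ca≢cb

other-rows : ∀ {n} (i : Fin (3 + n)) →
  ∃₂ λ i′ i″ → i ≢ i′ × i ≢ i″ × i′ ≢ i″
other-rows 0F            = 1F , 2F , (λ ()) , (λ ()) , (λ ())
other-rows 1F            = 0F , 2F , (λ ()) , (λ ()) , (λ ())
other-rows (suc (suc i)) = 0F , 1F , (λ ()) , (λ ()) , (λ ())

-- Cells of the grid and cuts of it.

Cell : ℕ → Set
Cell n = Fin n × ℕ

position : ∀ {n} → Cell n → ℕ × ℕ
position (i , j) = toℕ i , j

CellAdj : Word → ∀ {n} → Cell n → Cell n → Set
CellAdj α u v = Adj (𝒫 α) (position u) (position v)

cellAdj-columns : ∀ α {n} {u v : Cell n} → CellAdj α u v →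
  proj₂ v ≡ suc (proj₂ u) ⊎ proj₂ u ≡ suc (proj₂ v)
cellAdj-columns α = Sum.map proj₁ proj₁

cellAdj⇒rowRel : ∀ α {n j} {i k : Fin n} →
  CellAdj α (i , j) (k , suc j) → RowRel (α j) (toℕ i) (toℕ k)
cellAdj⇒rowRel α (inj₁ (_ , r)) = r
cellAdj⇒rowRel α (inj₂ (eq , _)) = contradiction eq (ℕ.m≢1+n+m _ {1})

Marks : ℕ → ℕ → Set
Marks n k = Cell n → Maybe (Fin k)

-- A marking records the labels of the cells of a set X, and nothing off X.
module Cut (α : Word) {n k L : ℕ} (mark : Marks (3 + n) k)
  (twins : ∀ {u u′ v a} → mark u ≡ just a → mark u′ ≡ just a →
           mark v ≡ nothing → proj₂ v < L → CellAdj α u v → CellAdj α u′ v)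
  where

  inside : Cell (3 + n) → Bool
  inside u = is-just (mark u)

  -- Cells exist in every column, also beyond the graph; `v<L` keeps the outer end where the twin
  -- condition holds.
  record CutEdge (j : ℕ) : Set where
    field
      {u v}     : Cell (3 + n)
      a         : Fin k
      u-in      : mark u ≡ just a
      v-out     : mark v ≡ nothing
      v<L       : proj₂ v < L
      u~v       : CellAdj α u v
      straddles : Straddles j (proj₂ u) (proj₂ v)

  open CutEdge

  edgeCode : ∀ {j} → CutEdge j → Fin (3 * k)
  edgeCode {j} e = combine (residue j) (a e)

  -- Equal labels make `u e` and `u f` twins, so `u f` is adjacent to `v e` and their columns are
  -- consecutive.
  edgeCode-injective : ∀ {i j} (e : CutEdge i) (f : CutEdge j) →
    edgeCode e ≡ edgeCode f → i ≡ j
  edgeCode-injective {i} {j} e f eq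
    with r , refl ← combine-injective (residue i) (a e) (residue j) (a f) eq =
    straddles-unique r (straddles e) (straddles f)
      (cellAdj-columns α {u = u f}
        (twins (u-in e) (u-in f) (v-out e) (v<L e) (u~v e)))

  bicoloured⇒cutEdge : ∀ {b i i′ j} → suc j < L → α j ≡ b → RowRel b (toℕ i) (toℕ i′) →
    inside (i , j) ≢ inside (i′ , suc j) → CutEdge j
  bicoloured⇒cutEdge {i = i} {i′} {j} j<L refl r differ
    with mark (i , j) in eq | mark (i′ , suc j) in eq′
  ... | just _  | just _  = contradiction refl differ
  ... | nothing | nothing = contradiction refl differ
  ... | just _  | nothing = record
    { u-in = eq ; v-out = eq′ ; v<L = j<L
    ; u~v = inj₁ (refl , r) ; straddles = inj₁ (refl , refl) }
  ... | nothing | just _  = record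
    { u-in = eq′ ; v-out = eq ; v<L = <-trans ≤-refl j<L
    ; u~v = inj₂ (refl , r) ; straddles = inj₂ (refl , refl) }

  -- The last row is adjacent to the whole column, whichever side it is on.
  mixed⇒cutEdge : ∀ {i i′ j} → suc j < L → α j ≡ 2F →
    inside (i , j) ≢ inside (i′ , j) → CutEdge j
  mixed⇒cutEdge {i} {i′} {j} j<L two differ =
    byTop (inside (i , j) ≟ᵇ inside (fromℕ _ , suc j))
    where
    below-top : ∀ x → toℕ x ≤ toℕ (fromℕ (2 + n))
    below-top x = ≤-trans (toℕ≤pred[n] x) (≤-reflexive (sym (toℕ-fromℕ (2 + n))))

    byTop : Dec (inside (i , j) ≡ inside (fromℕ (2 + n) , suc j)) → CutEdge j
    byTop (no ≢top)  = bicoloured⇒cutEdge j<L two (below-top i) ≢top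
    byTop (yes ≡top) = bicoloured⇒cutEdge j<L two (below-top i′) (differ ∘ trans ≡top ∘ sym)

  change⇒cutEdge : ∀ {i j} → suc j < L →
    inside (i , j) ≢ inside (i , suc j) → CutEdge j
  change⇒cutEdge {i} {j} j<L differ = byLetter (α j) refl
    where
    byLetter : ∀ b → α j ≡ b → CutEdge j
    byLetter 0F eq = bicoloured⇒cutEdge j<L eq refl differ
    byLetter 2F eq = bicoloured⇒cutEdge j<L eq ≤-refl differ
    -- The two cells of row `i` are not adjacent here. They are joined by the path `(i , j)`,
    -- `(i″ , suc j)`, `(i′ , j)`, `(i , suc j)`, one of whose three edges must change side.
    byLetter 1F eq with i′ , i″ , i≢i′ , i≢i″ , i′≢i″ ← other-rows i
      with inside (i , j) ≟ᵇ inside (i″ , suc j) | inside (i′ , j) ≟ᵇ inside (i , suc j)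
    ... | no  ≢″ | _      = bicoloured⇒cutEdge j<L eq (i≢i″ ∘ toℕ-injective) ≢″
    ... | yes _  | no  ≢′ = bicoloured⇒cutEdge j<L eq (i≢i′ ∘ sym ∘ toℕ-injective) ≢′
    ... | yes p  | yes q  =
      bicoloured⇒cutEdge j<L eq (i′≢i″ ∘ toℕ-injective) (λ r → differ (trans p (trans (sym r) q)))

  -- The direction, out of the marked set or into it, is an element of `Fin 2` so that it can enter
  -- a numeric code.
  Crossing : Fin 2 → Fin k → Fin (3 + n) → ℕ → Set
  Crossing 0F a i j = mark (i , j) ≡ just a × mark (i , suc j) ≡ nothing
  Crossing 1F a i j = mark (i , j) ≡ nothing × mark (i , suc j) ≡ just a

  change⇒crossing : ∀ {i j} → inside (i , j) ≢ inside (i , suc j) →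
    ∃₂ λ d a → Crossing d a i j
  change⇒crossing {i} {j} differ with mark (i , j) in eq | mark (i , suc j) in eq′
  ... | just _  | just _  = contradiction refl differ
  ... | nothing | nothing = contradiction refl differ
  ... | just a  | nothing = 0F , a , eq , eq′
  ... | nothing | just a  = 1F , a , eq , eq′

  -- The marked ends of the two crossings are twins with respect to both unmarked ends, which forces
  -- equal rows whatever the letter.
  crossing-injective : ∀ d {a i i′ j} → suc j < L →
    Crossing d a i j → Crossing d a i′ j → i ≡ i′
  crossing-injective 0F {i = i} {i′} {j} j<L (p , q) (p′ , q′) =
    toℕ-injective (rowRel-separatesˡ (α j)
      (λ r → transfer p p′ q r) (λ r → transfer p′ p q′ r) (λ r → transfer p′ p q r))
    where
    transfer : ∀ {a x x′ y} → mark (x , j) ≡ just a → mark (x′ , j) ≡ just a →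
      mark (y , suc j) ≡ nothing →
      RowRel (α j) (toℕ x) (toℕ y) → RowRel (α j) (toℕ x′) (toℕ y)
    transfer {x = x} {x′} {y} p p′ q r =
      cellAdj⇒rowRel α {i = x′} {y} (twins p p′ q j<L (inj₁ (refl , r)))
  crossing-injective 1F {i = i} {i′} {j} j<L (q , p) (q′ , p′) =
    toℕ-injective (rowRel-separatesʳ (α j)
      (λ r → transfer p p′ q r) (λ r → transfer p′ p q′ r) (λ r → transfer p′ p q r))
    where
    transfer : ∀ {a x x′ y} → mark (x , suc j) ≡ just a → mark (x′ , suc j) ≡ just a →
      mark (y , j) ≡ nothing →
      RowRel (α j) (toℕ y) (toℕ x) → RowRel (α j) (toℕ y) (toℕ x′)
    transfer {x = x} {x′} {y} p p′ q r =
      cellAdj⇒rowRel α {i = y} {x′}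
        (Sum.swap (twins p p′ q (<-trans ≤-refl j<L) (inj₂ (refl , r))))

  full-empty⇒few-rows : ∀ {s t} → s < L → t < L →
    (∀ i → inside (i , s) ≡ true) → (∀ i → inside (i , t) ≡ false) →
    3 + n ≤ 3 * k * (2 * k)
  full-empty⇒few-rows {s} {t} s<L t<L full empty =
    injective⇒≤ {f = rowCode} λ {i} {i′} → inj i i′
    where
    differs : ∀ i → inside (i , s) ≢ inside (i , t)
    differs i eq with () ← trans (sym (full i)) (trans eq (empty i))

    turn : ∀ i → ∃ λ j → suc j < L × inside (i , j) ≢ inside (i , suc j)
    turn i = change (λ j → inside (i , j)) s<L t<L (differs i)

    edge : ∀ i → CutEdge (proj₁ (turn i))
    edge i = let _ , j<L , differ = turn i in change⇒cutEdge j<L differ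

    crossing : ∀ i → ∃₂ λ d a → Crossing d a i (proj₁ (turn i))
    crossing i = change⇒crossing (proj₂ (proj₂ (turn i)))

    direction : ∀ i → Fin 2
    direction i = proj₁ (crossing i)

    rowLabel : ∀ i → Fin k
    rowLabel i = proj₁ (proj₂ (crossing i))

    -- The cut edge need not lie in row `i`; its code serves only to identify the gap at which the
    -- row turns.
    rowCode : Fin (3 + n) → Fin (3 * k * (2 * k))
    rowCode i = combine (edgeCode (edge i)) (combine (direction i) (rowLabel i))

    unique : ∀ {d d′ a a′ i i′ j j′} → suc j < L →
      Crossing d a i j → Crossing d′ a′ i′ j′ →
      j ≡ j′ → d ≡ d′ → a ≡ a′ → i ≡ i′
    unique {d} j<L c c′ refl refl refl = crossing-injective d j<L c c′

    inj : ∀ i i′ → rowCode i ≡ rowCode i′ → i ≡ i′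
    inj i i′ eq =
      let p , q = combine-injective (edgeCode (edge i)) _ (edgeCode (edge i′)) _ eq
          d , a = combine-injective (direction i) (rowLabel i) (direction i′) (rowLabel i′) q
      in unique (proj₁ (proj₂ (turn i))) (proj₂ (proj₂ (crossing i)))
           (proj₂ (proj₂ (crossing i′))) (edgeCode-injective (edge i) (edge i′) p) d a

-- The premise of twins on z is vacuous for v outside the part. It is kept for v
-- inside, so that the property passes from s ⊕ t to s and t.
record Placement (α : Word) (n L : ℕ) {k : ℕ} (A : LabelledGraph k) : Set where
  field
    place     : Vertex (graph A) → Cell n
    injective : ∀ {x y} → place x ≡ place y → x ≡ y
    occupied? : ∀ u → Dec (∃ λ x → place x ≡ u)
    twins     : ∀ {x x′ v} → label A x ≡ label A x′ → proj₂ v < L →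
                (∀ z → place z ≡ v → Adj (graph A) x z → Adj (graph A) x′ z) →
                CellAdj α (place x) v → CellAdj α (place x′) v

  Full : ℕ → Set
  Full j = ∀ i → ∃ λ x → place x ≡ (i , j)

open Placement

-- Placements of subexpressions.

module _ {α : Word} {n L k : ℕ} where

  -- Whether a join adds an edge depends only on labels, so an added edge at `x` is also added at
  -- `x′`; older edges transfer by `h`.
  joinedPart : ∀ {i j : Fin k} {i≢j : i ≢ j} {A : LabelledGraph k} →
    Placement α n L (joinᴸ i j i≢j A) → Placement α n L A
  joinedPart P = record
    { place = place P ; injective = injective P ; occupied? = occupied? P
    ; twins = λ x≈x′ v<L h → twins P x≈x′ v<L λ
        { z e (inj₁ a) → inj₁ (h z e a)
        ; z e (inj₂ (inj₁ (p , q))) → inj₂ (inj₁ (trans (sym x≈x′) p , q))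
        ; z e (inj₂ (inj₂ (p , q))) → inj₂ (inj₂ (p , trans (sym x≈x′) q)) } }

  relabelledPart : ∀ {i j : Fin k} {A : LabelledGraph k} →
    Placement α n L (relabelᴸ i j A) → Placement α n L A
  relabelledPart {i} {j} P = record
    { place = place P ; injective = injective P ; occupied? = occupied? P
    -- The function under `cong` is the renaming map on labels.
    ; twins = λ x≈x′ → twins P (cong (λ l → label (relabelᴸ i j (singleᴸ l)) tt) x≈x′) }

  -- A union has no edges between its two sides, so the premise on `z` needs checking on one side
  -- only.
  leftPart : ∀ {A B : LabelledGraph k} →
    Placement α n L (unionᴸ A B) → Placement α n L A
  leftPart {A} {B} P = record
    { place = place P ∘ inj₁
    ; injective = inj₁-injective ∘ injective P
    ; occupied? = λ u → part? u (occupied? P u)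
    ; twins = λ x≈x′ v<L h → twins P x≈x′ v<L λ { (inj₁ z) e (inj₁ a) → inj₁ (h z e a) } }
    where
    part? : ∀ u → Dec (∃ λ x → place P x ≡ u) → Dec (∃ λ x → place P (inj₁ x) ≡ u)
    part? u (yes (inj₁ x , e)) = yes (x , e)
    -- By injectivity, a cell held by the other side is free in this one.
    part? u (yes (inj₂ y , e)) = no λ (x , e′) →
      contradiction (injective P (trans e′ (sym e))) λ ()
    part? u (no ∄)             = no λ (x , e) → ∄ (inj₁ x , e)

  rightPart : ∀ {A B : LabelledGraph k} →
    Placement α n L (unionᴸ A B) → Placement α n L B
  rightPart {A} {B} P = record
    { place = place P ∘ inj₂
    ; injective = inj₂-injective ∘ injective P
    ; occupied? = λ u → part? u (occupied? P u)
    ; twins = λ x≈x′ v<L h → twins P x≈x′ v<L λ { (inj₂ z) e (inj₂ a) → inj₂ (h z e a) } }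
    where
    part? : ∀ u → Dec (∃ λ x → place P x ≡ u) → Dec (∃ λ x → place P (inj₂ x) ≡ u)
    part? u (yes (inj₂ x , e)) = yes (x , e)
    part? u (yes (inj₁ y , e)) = no λ (x , e′) →
      contradiction (injective P (trans e′ (sym e))) λ ()
    part? u (no ∄)             = no λ (x , e) → ∄ (inj₂ x , e)

-- The cut defined by a placement.

module PlacementCut {α : Word} {n L k : ℕ} {A : LabelledGraph k}
                    (P : Placement α (3 + n) L A) where

  markOf : ∀ {u} → Dec (∃ λ x → place P x ≡ u) → Maybe (Fin k)
  markOf (yes (x , _)) = just (label A x)
  markOf (no _)        = nothing

  mark : Marks (3 + n) k
  mark u = markOf (occupied? P u)

  mark-just : ∀ {u a} → mark u ≡ just a → ∃ λ x → place P x ≡ u × label A x ≡ a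
  mark-just {u} eq with occupied? P u
  ... | yes (x , e) = x , e , just-injective eq

  mark-nothing : ∀ {u} → mark u ≡ nothing → ¬ ∃ λ x → place P x ≡ u
  mark-nothing {u} eq with occupied? P u
  ... | no ∄ = ∄

  mark-twins : ∀ {u u′ v a} → mark u ≡ just a → mark u′ ≡ just a →
    mark v ≡ nothing → proj₂ v < L → CellAdj α u v → CellAdj α u′ v
  mark-twins p p′ q v<L
    with x , refl , l ← mark-just p | x′ , refl , l′ ← mark-just p′ =
    twins P (trans l (sym l′)) v<L λ z e _ → contradiction (z , e) (mark-nothing q)

  open Cut α mark mark-twins public

  inside-true : ∀ {u} → (∃ λ x → place P x ≡ u) → inside u ≡ true
  inside-true {u} occ with occupied? P u
  ... | yes _ = refl
  ... | no ∄  = contradiction occ ∄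

  inside-false : ∀ {u} → ¬ (∃ λ x → place P x ≡ u) → inside u ≡ false
  inside-false {u} ∄ with occupied? P u
  ... | yes occ = contradiction occ ∄
  ... | no _    = refl

  cutEdge-or-empty : ∀ {j} → suc j < L → α j ≡ 2F → ¬ Full P j →
    CutEdge j ⊎ (∀ i → ¬ ∃ λ x → place P x ≡ (i , j))
  cutEdge-or-empty {j} j<L two ¬full with any? (λ i → occupied? P (i , j))
  ... | no ∄ = inj₂ λ i occ → ∄ (i , occ)
  ... | yes (i , occ)
    with i′ , ¬occ ← ¬∀⟶∃¬ _ _ (λ i → occupied? P (i , j)) ¬full =
    inj₁ (mixed⇒cutEdge {i} {i′} j<L two λ eq →
      contradiction (trans (sym (inside-true occ)) (trans eq (inside-false ¬occ))) λ ())

open PlacementCut using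
  (CutEdge; edgeCode; edgeCode-injective; cutEdge-or-empty; inside-true; inside-false;
   full-empty⇒few-rows)

-- Induction on expressions.

module _ {α : Word} {n L M k : ℕ} (p : Fin M → ℕ)
  (p-injective : ∀ {i j} → p i ≡ p j → i ≡ j)
  (two : ∀ m → α (p m) ≡ 2F) (p<L : ∀ m → suc (p m) < L)
  (many-rows : 3 * k * (2 * k) < 3 + n) (many-columns : 3 * k + 3 * k < M)
  where

  -- Joins and renamings keep the occupied cells. If a union fills a column, every column `p m′` is
  -- cut by one of its two sides, and each side has only `3 * k` edge codes.
  no-full-column : (t : Expr k) (P : Placement α (3 + n) L ⟦ t ⟧) →
    ∀ m → ¬ Full P (p m)
  no-full-column (single _) P m full
    with tt , e ← full 0F | tt , e′ ← full 1F
    with () ← ,-injectiveˡ (trans (sym e) e′)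
  no-full-column (η i j i≢j t) P = no-full-column t (joinedPart P)
  no-full-column (ρ i j t)     P = no-full-column t (relabelledPart P)
  no-full-column (s ⊕ t)       P m full =
    contradiction (injective⇒≤ {f = code} λ {i} {j} → code-injective i j) (<⇒≱ many-columns)
    where
    Pˡ = leftPart {A = ⟦ s ⟧} {⟦ t ⟧} P
    Pʳ = rightPart {A = ⟦ s ⟧} {⟦ t ⟧} P

    cut : ∀ m′ → CutEdge Pˡ (p m′) ⊎ CutEdge Pʳ (p m′)
    cut m′
      with cutEdge-or-empty Pˡ (p<L m′) (two m′) (no-full-column s Pˡ m′)
         | cutEdge-or-empty Pʳ (p<L m′) (two m′) (no-full-column t Pʳ m′)
    ... | inj₁ e | _      = inj₁ e
    ... | inj₂ _ | inj₁ e = inj₂ e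
    -- Both sides miss column `p m′`, so the union misses it while filling column `p m`.
    ... | inj₂ ∄ˡ | inj₂ ∄ʳ =
      contradiction
        (full-empty⇒few-rows P (<-trans ≤-refl (p<L m)) (<-trans ≤-refl (p<L m′))
          (λ i → inside-true P (full i))
          (λ i → inside-false P λ { (inj₁ x , e) → ∄ˡ i (x , e)
                                  ; (inj₂ x , e) → ∄ʳ i (x , e) }))
        (<⇒≱ many-rows)

    sideCode : ∀ {j} → CutEdge Pˡ j ⊎ CutEdge Pʳ j → Fin (3 * k) ⊎ Fin (3 * k)
    sideCode = Sum.map (edgeCode Pˡ) (edgeCode Pʳ)

    sideCode-injective : ∀ {i j} (e : CutEdge Pˡ i ⊎ CutEdge Pʳ i)
      (f : CutEdge Pˡ j ⊎ CutEdge Pʳ j) → sideCode e ≡ sideCode f → i ≡ j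
    sideCode-injective (inj₁ e) (inj₁ f) eq = edgeCode-injective Pˡ e f (inj₁-injective eq)
    sideCode-injective (inj₂ e) (inj₂ f) eq = edgeCode-injective Pʳ e f (inj₂-injective eq)

    code : Fin M → Fin (3 * k + 3 * k)
    code m′ = join (3 * k) (3 * k) (sideCode (cut m′))

    code-injective : ∀ i j → code i ≡ code j → i ≡ j
    code-injective i j eq = p-injective (sideCode-injective (cut i) (cut j)
      (trans (sym (splitAt-join (3 * k) (3 * k) (sideCode (cut i))))
        (trans (cong (splitAt (3 * k)) eq)
               (splitAt-join (3 * k) (3 * k) (sideCode (cut j))))))

-- Expressions for finite induced subgraphs.

module _ {K : ℕ} where

  -- Every expression creates a vertex, hence `suc m`.
  discrete : ∀ {m} → (Fin (suc m) → Fin K) → Expr K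
  discrete {zero}  f = single (f zero)
  discrete {suc m} f = single (f zero) ⊕ discrete (f ∘ suc)

  discrete-bijection : ∀ {m} (f : Fin (suc m) → Fin K) →
    Vertex (graph ⟦ discrete f ⟧) ↔ Fin (suc m)
  discrete-bijection {zero} f =
    mk↔ₛ′ (λ _ → zero) (λ _ → tt) (λ { zero → refl }) (λ _ → refl)
  discrete-bijection {suc m} f = mk↔ₛ′
    (λ { (inj₁ _) → zero ; (inj₂ y) → suc (to y) })
    (λ { zero → inj₁ tt ; (suc y) → inj₂ (from y) })
    (λ { zero → refl ; (suc y) → cong suc (strictlyInverseˡ y) })
    (λ { (inj₁ _) → refl ; (inj₂ y) → cong inj₂ (strictlyInverseʳ y) })
    where open Inverse (discrete-bijection (f ∘ suc))

  discrete-label : ∀ {m} (f : Fin (suc m) → Fin K) x →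
    label ⟦ discrete f ⟧ x ≡ f (Inverse.to (discrete-bijection f) x)
  discrete-label {zero}  f _        = refl
  discrete-label {suc m} f (inj₁ _) = refl
  discrete-label {suc m} f (inj₂ y) = discrete-label (f ∘ suc) y

  discrete-edgeless : ∀ {m} (f : Fin (suc m) → Fin K) x y →
    ¬ Adj (graph ⟦ discrete f ⟧) x y
  discrete-edgeless {suc m} f _ _ (inj₂ e) = discrete-edgeless (f ∘ suc) _ _ e

module _ (H : Graph) (adj? : Decidable (Adj H)) {n : ℕ} (f : Fin (suc n) ↣ Vertex H) where

  private
    G = induced H f
    N = suc n

  -- Each vertex keeps a label of its own, so one join adds one edge. Only `complete` depends on the
  -- list; once all pairs are listed, the bijection is an isomorphism.
  record Built (edges : List (Fin N × Fin N)) : Set where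
    field
      expr      : Expr N
      bijection : Vertex (graph ⟦ expr ⟧) ↔ Fin N
    open Inverse bijection public using (to; from; strictlyInverseˡ)
    field
      labelled  : ∀ x → label ⟦ expr ⟧ x ≡ to x
      sound     : ∀ {x y} → Adj (graph ⟦ expr ⟧) x y → Adj G (to x) (to y)
      complete  : ∀ {x y} → (to x , to y) ∈ edges → Adj G (to x) (to y) →
                  Adj (graph ⟦ expr ⟧) x y

  build : ∀ edges → Built edges
  build [] = record
    { expr = discrete (λ i → i)
    ; bijection = discrete-bijection (λ i → i)
    ; labelled = discrete-label (λ i → i)
    ; sound = λ {x} {y} e → contradiction e (discrete-edgeless {m = n} (λ i → i) x y)
    ; complete = λ () }
  build ((i , j) ∷ edges) with build edges | adj? (Injection.to f i) (Injection.to f j)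
  ... | B | no ¬ij = record
    { expr = expr ; bijection = bijection ; labelled = labelled ; sound = sound
    ; complete = λ { (here refl) ij → contradiction ij ¬ij
                   ; (there m) e → complete m e } }
    where open Built B
  ... | B | yes ij = record
    { expr = η i j (λ i≡j → loopless G i≡j ij) expr
    ; bijection = bijection
    ; labelled = labelled
    ; sound = λ
        { (inj₁ e) → sound e
        ; (inj₂ (inj₁ (p , q))) → joined p q
        ; (inj₂ (inj₂ (p , q))) → adj-sym G (joined p q) }
    ; complete = λ
        { (here refl) _ → inj₂ (inj₁ (labelled _ , labelled _))
        ; (there m) e → inj₁ (complete m e) } }
    where
    open Built B
    joined : ∀ {x y} → label ⟦ expr ⟧ x ≡ i → label ⟦ expr ⟧ y ≡ j → Adj G (to x) (to y)
    joined {x} {y} refl refl rewrite sym (labelled x) | sym (labelled y) = ij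

  -- `BoundedCliqueWidth` constrains only graphs that have a clique-width. An expression with any
  -- number of labels excludes that the grid has none.
  induced-constructible : ConstructibleWith N G
  induced-constructible =
    expr , bijection , λ x y → mk⇔ sound
      (complete (∈-cartesianProduct⁺ (∈-allFin _) (∈-allFin _)))
    where open Built (build (cartesianProduct (allFin N) (allFin N)))

-- The grid and the placement of its whole expression.

module Grid (α : Word) (n L : ℕ) where

  cell : Fin (n * L) → Cell n
  cell x = let i , j = remQuot {n} L x in i , toℕ j

  cell-injective : ∀ {x y} → cell x ≡ cell y → x ≡ y
  cell-injective {x} {y} eq = trans (sym (combine-remQuot {n} L x))
    (trans (cong₂ combine (cong proj₁ eq) (toℕ-injective (cong proj₂ eq)))
           (combine-remQuot {n} L y))

  cell-combine : ∀ i {j} (j<L : j < L) → cell (combine i (fromℕ< j<L)) ≡ (i , j)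
  cell-combine i j<L =
    trans (cong (λ (i , j) → i , toℕ j) (remQuot-combine i (fromℕ< j<L)))
          (cong (i ,_) (toℕ-fromℕ< j<L))

  cell<L : ∀ x → proj₂ (cell x) < L
  cell<L x = toℕ<n (proj₂ (remQuot {n} L x))

  embedding : Fin (n * L) ↣ (ℕ × ℕ)
  embedding = mk↣ {to = position ∘ cell} λ eq →
    cell-injective (cong₂ _,_ (toℕ-injective (cong proj₁ eq)) (cong proj₂ eq))

  grid : Graph
  grid = induced (𝒫 α) embedding

  grid∈𝒢 : 𝒢 α grid
  grid∈𝒢 = n * L , embedding , mk↔ₛ′ (λ x → x) (λ x → x) (λ _ → refl) (λ _ → refl) ,
           λ _ _ → mk⇔ (λ e → e) (λ e → e)

  module _ {k : ℕ} (t : Expr k) (iso : graph ⟦ t ⟧ ≅ grid) where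

    open Inverse (proj₁ iso)

    private
      covers : ∀ i {j} → j < L → ∃ λ x → cell (to x) ≡ (i , j)
      covers i j<L = from (combine i (fromℕ< j<L)) ,
        trans (cong cell (strictlyInverseˡ _)) (cell-combine i j<L)

    rootPlacement : Placement α n L ⟦ t ⟧
    rootPlacement = record
      { place     = cell ∘ to
      ; injective = λ {x} {y} eq → trans (sym (strictlyInverseʳ x))
                      (trans (cong from (cell-injective eq)) (strictlyInverseʳ y))
      ; occupied? = root?
      ; twins     = λ {x} {x′} {v} → root-twins x x′ v }
      where
      root? : ∀ u → Dec (∃ λ x → cell (to x) ≡ u)
      root? (i , j) with j <? L
      ... | yes j<L = yes (covers i j<L)
      ... | no  j≮L = no λ { (x , refl) → j≮L (cell<L (to x)) }

      root-twins : ∀ x x′ v → label ⟦ t ⟧ x ≡ label ⟦ t ⟧ x′ → proj₂ v < L →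
        (∀ z → cell (to z) ≡ v → Adj (graph ⟦ t ⟧) x z → Adj (graph ⟦ t ⟧) x′ z) →
        -- All cells in columns below `L` are occupied, so `h` applies to the vertex at `v`, and the
        -- isomorphism translates adjacency both ways.
        CellAdj α (cell (to x)) v → CellAdj α (cell (to x′)) v
      root-twins x x′ (i , j) _ v<L h adj with z , refl ← covers i v<L =
        Equivalence.to (proj₂ iso x′ z) (h z refl (Equivalence.from (proj₂ iso x z) adj))

    rootPlacement-full : ∀ {j} → j < L → Full rootPlacement j
    rootPlacement-full j<L i = covers i j<L

-- Increasing enumeration of occurrences of a letter.

module Occurrences {a : Fin 3} {α : Word} (often : InfinitelyOften a α) where

  occurrence : ℕ → ℕ
  occurrence zero    = proj₁ (often 0)
  occurrence (suc m) = proj₁ (often (suc (occurrence m)))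

  α-occurrence : ∀ m → α (occurrence m) ≡ a
  α-occurrence zero    = proj₂ (proj₂ (often 0))
  α-occurrence (suc m) = proj₂ (proj₂ (often (suc (occurrence m))))

  occurrence-step : ∀ m → occurrence m < occurrence (suc m)
  occurrence-step m = proj₁ (proj₂ (often (suc (occurrence m))))

  occurrence-mono-< : ∀ {i j} → i < j → occurrence i < occurrence j
  occurrence-mono-< {i} {suc j} (s≤s i≤j) with ℕ.m≤n⇒m<n∨m≡n i≤j
  ... | inj₁ i<j  = <-trans (occurrence-mono-< i<j) (occurrence-step j)
  ... | inj₂ refl = occurrence-step j

  occurrence-injective : ∀ {i j} → occurrence i ≡ occurrence j → i ≡ j
  occurrence-injective {i} {j} eq with <-cmp i j
  ... | tri< i<j _ _ = contradiction (occurrence-mono-< i<j) (<-irrefl eq)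
  ... | tri≈ _ i≡j _ = i≡j
  ... | tri> _ _ j<i = contradiction (occurrence-mono-< j<i) (<-irrefl (sym eq))

-- The least number of labels cannot be computed, but it may be assumed to exist
-- when the goal is a contradiction.
no-cliqueWidth⇒¬constructible : ∀ {G} → (∀ k → ¬ IsCliqueWidth G k) →
  ∀ k → ¬ ConstructibleWith k G
no-cliqueWidth⇒¬constructible {G} none = <-rec (λ k → ¬ ConstructibleWith k G)
  λ k rec c → none k (c , λ j cj → ≮⇒≥ λ j<k → rec j<k cj)

lemma9 : (α : Word) → InfinitelyOften 2F α → ¬ BoundedCliqueWidth (𝒢 α)
lemma9 α often (c , bound) =
  no-cliqueWidth⇒¬constructible {grid} wide _
    (induced-constructible (𝒫 α) (𝒫-adj? α) embedding)
  where
  open Occurrences often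
  -- `3 + n` exceeds the number of row codes for `c` labels, and `M` exceeds the number of edge
  -- codes of two sides; `k≤c` carries both counts over to `k`.
  n = 3 * c * (2 * c)
  M = suc (3 * c + 3 * c)
  -- Every `p m` comes before `occurrence M`, so both columns of its gap lie below `L`.
  L = suc (suc (occurrence M))
  open Grid α (3 + n) L

  p : Fin M → ℕ
  p m = occurrence (toℕ m)

  p<L : ∀ m → suc (p m) < L
  p<L m = s≤s (s≤s (ℕ.<⇒≤ (occurrence-mono-< (toℕ<n m))))

  wide : ∀ k → ¬ IsCliqueWidth grid k
  wide k w@((t , iso) , _) =
    no-full-column p (toℕ-injective ∘ occurrence-injective) (α-occurrence ∘ toℕ) p<L
      (s≤s (≤-trans (*-mono-≤ 3k≤3c (*-monoʳ-≤ 2 k≤c)) (ℕ.m≤n+m n 2)))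
      (s≤s (+-mono-≤ 3k≤3c 3k≤3c))
      t (rootPlacement t iso) zero
      (rootPlacement-full t iso (<-trans ≤-refl (p<L zero)))
    where
    k≤c : k ≤ c
    k≤c = bound grid grid∈𝒢 k w
    3k≤3c : 3 * k ≤ 3 * c
    3k≤3c = *-monoʳ-≤ 3 k≤c
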